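{- $t(2)=3$.
   Context: Let $\mathfrak{C}=\{0,1\}^n$ be the vertex set of the $n$-dimensional hypercube; $\oplus,\wedge$ denote bitwise XOR and AND. An outmap is any function $s:\mathfrak{C}\to\{0,1\}^n$. A clash of $s$ is a pair of distinct vertices $u,v$ with $(s(u)\oplus s(v))\wedge(u\oplus v)=0^n$. A query at $u$ to the oracle for $s$ returns $s(u)$; algorithms choose queries adaptively, and only the number of queries is counted. \textsc{Sink-or-Clash}: given oracle access to an arbitrary outmap $s$, query either a vertex $u$ with $s(u)=0^n$ or both vertices of some clash. $t(n)=\min_{\mathcal A}\max_s t(\mathcal A,s)$, where $\mathcal A$ ranges over deterministic algorithms solving \textsc{Sink-or-Clash} on all outmaps of the $n$-cube and $t(\mathcal A,s)$ is the number of queries made on $s$. -}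

module Defs where

open import Data.Bool.Base using (Bool; false; _∧_; _xor_)
open import Data.List.Base using (List; []; _∷_; length)
open import Data.List.Membership.Propositional using (_∈_)
open import Data.Nat.Base using (ℕ; _≤_)
open import Data.Product.Base using (∃; ∃-syntax; _×_)
open import Data.Sum.Base using (_⊎_)
open import Data.Vec.Base using (Vec; zipWith; replicate)
open import Relation.Binary.PropositionalEquality.Core using (_≡_; _≢_)

Bits : ℕ → Set
Bits = Vec Bool

infixr 5 _⊕_
infixr 6 _⊓_

_⊕_ : ∀ {n} → Bits n → Bits n → Bits n
_⊕_ = zipWith _xor_

-- Bitwise AND.
_⊓_ : ∀ {n} → Bits n → Bits n → Bits n
_⊓_ = zipWith _∧_

𝟎 : ∀ {n} → Bits n
𝟎 = replicate _ false

Outmap : ℕ → Set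
Outmap n = Bits n → Bits n

IsSink : ∀ {n} → Outmap n → Bits n → Set
IsSink s u = s u ≡ 𝟎

IsClash : ∀ {n} → Outmap n → Bits n → Bits n → Set
IsClash s u v = u ≢ v × (s u ⊕ s v) ⊓ (u ⊕ v) ≡ 𝟎

-- A deterministic adaptive algorithm on the n-cube, as a decision tree: it
-- either halts or queries a vertex and continues depending on the answer.
-- Since answers range over a finite set, requiring the tree to be well founded
-- loses nothing compared with requiring termination on every outmap.
data Algorithm (n : ℕ) : Set where
  halt  : Algorithm n
  query : (u : Bits n) (continue : Bits n → Algorithm n) → Algorithm n

queried : ∀ {n} → Algorithm n → Outmap n → List (Bits n)
queried halt        s = []
queried (query u k) s = u ∷ queried (k (s u)) s

-- Repeated queries to the same vertex are counted each time.
#queries : ∀ {n} → Algorithm n → Outmap n → ℕ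
#queries A s = length (queried A s)

SolvesSinkOrClash : ∀ {n} → Algorithm n → Set
SolvesSinkOrClash {n} A = (s : Outmap n) →
  (∃[ u ] u ∈ queried A s × IsSink s u) ⊎
  (∃[ u ] ∃[ v ] u ∈ queried A s × v ∈ queried A s × IsClash s u v)

IsMin : (ℕ → Set) → ℕ → Set
IsMin P m = P m × (∀ k → P k → m ≤ k)

IsMax : (ℕ → Set) → ℕ → Set
IsMax P m = P m × (∀ k → P k → k ≤ m)

-- m = max_s t(A , s).  The maximum always exists, because up to pointwise
-- equality there are only finitely many outmaps.
IsWorstCase : ∀ {n} → Algorithm n → ℕ → Set
IsWorstCase A = IsMax (λ k → ∃[ s ] #queries A s ≡ k)

-- t[ n ]= m  states that m = min_A max_s t(A , s), with A ranging over the
-- algorithms solving Sink-or-Clash on all outmaps of the n-cube.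
t[_]=_ : ℕ → ℕ → Set
t[ n ]= m = IsMin (λ k → ∃ λ (A : Algorithm n) → SolvesSinkOrClash A × IsWorstCase A k) m

{-# OPTIONS --safe #-}

-- Upper bound: walk from 𝟎 by v ↦ v ⊕ s v; on the square the first three
-- vertices of this walk always contain a sink or a clash.
--
-- Lower bound: after the first query u, an outmap with no sink at all and no
-- clash involving u is still possible, and two queries can only exhibit
-- clashes involving u.

module Submission where

open import Defs
open import Data.Bool.Base using (true; false)
import Data.Bool.Properties as Bool
open import Data.Fin.Subset.Properties using (anySubset?)
open import Data.List.Base using (List; []; _∷_; length)
open import Data.List.Membership.Propositional using (_∈_)
open import Data.List.Relation.Unary.Any using (here; there)
open import Data.Nat.Base using (_≤_; z≤n; s≤s)
open import Data.Nat.Properties using (≤-trans; ≤-reflexive)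
open import Data.Product.Base using (∃-syntax; _×_; _,_)
open import Data.Sum.Base using (_⊎_; inj₁; inj₂)
open import Data.Vec.Base using ([]; _∷_)
open import Data.Vec.Properties using (≡-dec; zipWith-comm)
open import Relation.Binary.Definitions using (DecidableEquality)
open import Relation.Binary.PropositionalEquality
  using (_≡_; _≢_; refl; sym; trans; cong₂; ≢-sym)
open import Relation.Nullary
  using (¬_; Dec; ¬?; _×-dec_; _⊎-dec_; contradiction; from-yes)
open import Relation.Nullary.Decidable using (map′; decidable-stable)
open import Relation.Unary using (Decidable)

infix 4 _≟_

_≟_ : ∀ {n} → DecidableEquality (Bits n)
_≟_ = ≡-dec Bool._≟_

-- `Bits n` is also the type of subsets of an `n`-element set, so an exhaustive subset search can
-- look for a counterexample to `P`.
allBits? : ∀ {n} {P : Bits n → Set} → Decidable P → Dec (∀ u → P u)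
allBits? P? = map′
  (λ ¬∃¬P u → decidable-stable (P? u) (λ ¬Pu → ¬∃¬P (u , ¬Pu)))
  (λ ∀P (u , ¬Pu) → ¬Pu (∀P u))
  (¬? (anySubset? (λ u → ¬? (P? u))))

-- IsClash s u v is, definitionally, Clashing u (s u) v (s v).
Clashing : ∀ {n} → Bits n → Bits n → Bits n → Bits n → Set
Clashing u x v y = u ≢ v × (x ⊕ y) ⊓ (u ⊕ v) ≡ 𝟎

clashing? : ∀ {n} (u x v y : Bits n) → Dec (Clashing u x v y)
clashing? u x v y = ¬? (u ≟ v) ×-dec ((x ⊕ y) ⊓ (u ⊕ v) ≟ 𝟎)

⊕-comm : ∀ {n} (u v : Bits n) → u ⊕ v ≡ v ⊕ u
⊕-comm = zipWith-comm Bool.xor-comm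

IsClash-sym : ∀ {n} (s : Outmap n) {u v} → IsClash s u v → IsClash s v u
IsClash-sym s {u} {v} (u≢v , eq) =
  ≢-sym u≢v , trans (cong₂ _⊓_ (⊕-comm (s v) (s u)) (⊕-comm v u)) eq

threeJumps : ∀ {n} → Algorithm n
threeJumps = query 𝟎 λ x → query x λ y → query (x ⊕ y) λ _ → halt

-- If `x` and `y` are nonzero and `𝟎`, `x` do not clash, then `y` is a single bit and `x` has the
-- other one. A `z` containing the bit of `y` gives a clash with `x`; the only other nonzero `z` is
-- the complement of `y`, which gives a clash with `𝟎`.
answersDecide : (x y z : Bits 2) →
  (x ≡ 𝟎 ⊎ y ≡ 𝟎 ⊎ z ≡ 𝟎) ⊎
  (Clashing 𝟎 x x y ⊎ Clashing 𝟎 x (x ⊕ y) z ⊎ Clashing x y (x ⊕ y) z)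
answersDecide = from-yes (allBits? λ (x : Bits 2) → allBits? λ y → allBits? λ z →
  (x ≟ 𝟎 ⊎-dec y ≟ 𝟎 ⊎-dec z ≟ 𝟎) ⊎-dec
  (clashing? 𝟎 x x y ⊎-dec clashing? 𝟎 x (x ⊕ y) z ⊎-dec clashing? x y (x ⊕ y) z))

threeJumps-solves : SolvesSinkOrClash (threeJumps {2})
threeJumps-solves s
  with answersDecide (s 𝟎) (s (s 𝟎)) (s (s 𝟎 ⊕ s (s 𝟎)))
... | inj₁ (inj₁ sink)         = inj₁ (_ , here refl , sink)
... | inj₁ (inj₂ (inj₁ sink))  = inj₁ (_ , there (here refl) , sink)
... | inj₁ (inj₂ (inj₂ sink))  = inj₁ (_ , there (there (here refl)) , sink)
... | inj₂ (inj₁ clash)        =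
  inj₂ (_ , _ , here refl , there (here refl) , clash)
... | inj₂ (inj₂ (inj₁ clash)) =
  inj₂ (_ , _ , here refl , there (there (here refl)) , clash)
... | inj₂ (inj₂ (inj₂ clash)) =
  inj₂ (_ , _ , there (here refl) , there (there (here refl)) , clash)

threeJumps-worstCase : ∀ {n} → IsWorstCase (threeJumps {n}) 3
-- No branch stops early, so every outmap costs exactly three queries and any one attains the
-- maximum.
threeJumps-worstCase = ((λ _ → 𝟎) , refl) , λ { _ (_ , refl) → ≤-reflexive refl }

SolvedBy : ∀ {n} → Outmap n → List (Bits n) → Set
SolvedBy s us =
  (∃[ u ] u ∈ us × IsSink s u) ⊎
  (∃[ u ] ∃[ v ] u ∈ us × v ∈ us × IsClash s u v)

solvedBy⇒3≤length : ∀ {n} {s : Outmap n} {u} →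
  (∀ v → ¬ IsSink s v) → (∀ v → ¬ IsClash s u v) →
  ∀ us → SolvedBy s (u ∷ us) → 3 ≤ length (u ∷ us)
solvedBy⇒3≤length noSink noClash (_ ∷ _ ∷ _) _ = s≤s (s≤s (s≤s z≤n))
solvedBy⇒3≤length noSink noClash _ (inj₁ (v , _ , sink)) =
  contradiction sink (noSink v)
solvedBy⇒3≤length noSink noClash _ (inj₂ (_ , v , here refl , _ , clash)) =
  contradiction clash (noClash v)
solvedBy⇒3≤length {s = s} noSink noClash _ (inj₂ (v , _ , _ , here refl , clash)) =
  contradiction (IsClash-sym s clash) (noClash v)
-- Both vertices come from a one-element tail, so they coincide.
solvedBy⇒3≤length noSink noClash (_ ∷ [])
  (inj₂ (_ , _ , there (here refl) , there (here refl) , v≢v , _)) =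
  contradiction refl v≢v

-- The answer at u is 11; at any v ≠ u it is 11 with one bit of u ⊕ v cleared.
adversary : Bits 2 → Outmap 2
adversary u v = answer (u ⊕ v)
  where
  answer : Bits 2 → Bits 2
  answer (_     ∷ true  ∷ []) = true  ∷ false ∷ []
  answer (true  ∷ false ∷ []) = false ∷ true  ∷ []
  answer (false ∷ false ∷ []) = true  ∷ true  ∷ []

adversary-noSink : ∀ u v → ¬ IsSink (adversary u) v
adversary-noSink = from-yes (allBits? λ (u : Bits 2) → allBits? λ v → ¬? (adversary u v ≟ 𝟎))

-- For `v` other than `u` the two answers differ in exactly one bit, and it is a bit of `u ⊕ v`, so
-- it survives the conjunction.
adversary-noClash : ∀ u v → ¬ IsClash (adversary u) u v
adversary-noClash = from-yes (allBits? λ (u : Bits 2) → allBits? λ v →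
  ¬? (clashing? u (adversary u u) v (adversary u v)))

needsThreeQueries : (A : Algorithm 2) → SolvesSinkOrClash A → ∃[ s ] 3 ≤ #queries A s
needsThreeQueries halt solves with solves (λ _ → 𝟎)
... | inj₁ (_ , () , _)
... | inj₂ (_ , _ , () , _)
-- The first query is made before any answer is seen, so the outmap may be chosen to depend on `u`.
needsThreeQueries (query u k) solves = adversary u ,
  solvedBy⇒3≤length (adversary-noSink u) (adversary-noClash u) _ (solves (adversary u))

lemma23 : t[ 2 ]= 3
lemma23 =
  (threeJumps , threeJumps-solves , threeJumps-worstCase) ,
  λ { _ (A , solves , _ , maximal) →
      let s , 3≤#queries = needsThreeQueries A solves
      in ≤-trans 3≤#queries (maximal _ (s , refl)) }
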